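{- Let $G=(V,E)$ be a connected graph with chromatic number $2$, let $\emptyset\ne V_c\subsetneq V$, and let $g:V_c\to\{0,1\}$ be such that no two adjacent vertices of $V_c$ have the same value under $g$. Let $f$ be a maximum contrast greyscale for the $\{0,1\}$-restricted maximum contrast problem on $G$ with initial colouring $g$. Then $\mathrm{Im}(f)\subseteq\{0,\frac13,\frac12,\frac23,1\}$.
   Context: Graphs are finite, undirected and simple. A greyscale of $G=(V,E)$ is a map $f:V\to[0,1]$ with $0,1\in \mathrm{Im}(f)$. For $e=\{u,v\}\in E$ put $\widehat f(e)=|f(u)-f(v)|$. The contrast vector $\mathcal C_f$ is the vector of all values $\widehat f(e)$, $e\in E$, listed in ascending order; contrast vectors are compared lexicographically. A greyscale $f$ is compatible with $g$ if $f(u)=g(u)$ for all $u\in V_c$. A maximum contrast greyscale for the $\{0,1\}$-restricted maximum contrast problem ($\{0,1\}$-RMACG) with data $(G,V_c,g)$ is a greyscale compatible with $g$ whose contrast vector is the lexicographic maximum among all greyscales of $G$ compatible with $g$. -}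

module Defs where

open import Algebra.Structures using (IsCommutativeRing)
open import Data.Bool.Base using (if_then_else_)
open import Data.Fin.Base using (Fin; zero; suc) renaming (_<_ to _<ᶠ_)
open import Data.Fin.Properties using () renaming (_<?_ to _<ᶠ?_)
open import Data.Fin.Subset using (Subset; _∈_)
open import Data.List.Base using (List; []; _∷_; allFin; cartesianProduct; filter; map)
import Data.List.Membership.Setoid as SetoidMembership
open import Data.List.Relation.Binary.Lex.NonStrict using (Lex-≤)
import Data.List.Sort as Sort
open import Data.Nat.Base using (ℕ) renaming (_≤_ to _≤ⁿ_)
open import Data.Product.Base using (Σ; ∃; _×_; _,_)
open import Level using (0ℓ) renaming (suc to lsuc)
open import Relation.Binary.Bundles using (DecTotalOrder; Setoid)
open import Relation.Binary.Construct.Closure.ReflexiveTransitive using (Star)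
open import Relation.Binary.Core using (Rel)
open import Relation.Binary.Definitions using (Decidable; Irreflexive; Symmetric)
open import Relation.Binary.PropositionalEquality using (_≡_; _≢_)
open import Relation.Binary.Structures using (IsDecTotalOrder)
open import Relation.Nullary.Decidable using (does; _×-dec_)
open import Relation.Nullary.Negation using (¬_)
open import Relation.Unary using (Pred)

-- The standard library has no real numbers.  They are characterised here, up
-- to isomorphism, as a Dedekind-complete ordered field.  The order is taken to
-- be decidable, as it is classically.  `_⁻¹` is total; its value at zero is
-- unspecified.
record Reals : Set (lsuc 0ℓ) where
  infix  4 _≈_ _≤_
  infixl 6 _+_ _-_
  infixl 7 _*_
  infix  8 -_
  infix  9 _⁻¹
  field
    Carrier           : Set
    _≈_ _≤_           : Rel Carrier 0ℓ
    _+_ _*_           : Carrier → Carrier → Carrier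
    -_ _⁻¹            : Carrier → Carrier
    0# 1#             : Carrier
    isCommutativeRing : IsCommutativeRing _≈_ _+_ _*_ -_ 0# 1#
    isDecTotalOrder   : IsDecTotalOrder _≈_ _≤_
    0≉1               : ¬ (0# ≈ 1#)
    ⁻¹-cong           : ∀ {x y} → x ≈ y → x ⁻¹ ≈ y ⁻¹
    ⁻¹-inverseʳ       : ∀ x → ¬ (x ≈ 0#) → x * x ⁻¹ ≈ 1#
    +-monoˡ-≤         : ∀ z {x y} → x ≤ y → x + z ≤ y + z
    *-nonNeg          : ∀ {x y} → 0# ≤ x → 0# ≤ y → 0# ≤ x * y

  UpperBound : Pred Carrier 0ℓ → Pred Carrier 0ℓ
  UpperBound S b = ∀ x → S x → x ≤ b

  field
    complete : ∀ (S : Pred Carrier 0ℓ) → ∃ S → ∃ (UpperBound S) →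
               ∃ λ s → UpperBound S s × (∀ b → UpperBound S b → s ≤ b)

  decTotalOrder : DecTotalOrder 0ℓ 0ℓ 0ℓ
  decTotalOrder = record { isDecTotalOrder = isDecTotalOrder }

  open DecTotalOrder decTotalOrder public using (_≤?_)

  setoid : Setoid 0ℓ 0ℓ
  setoid = DecTotalOrder.Eq.setoid decTotalOrder

  _-_ : Carrier → Carrier → Carrier
  x - y = x + (- y)

  ∣_∣ : Carrier → Carrier
  ∣ x ∣ = if does (0# ≤? x) then x else - x

  ½ ⅓ ⅔ : Carrier
  ½ = (1# + 1#) ⁻¹
  ⅓ = (1# + 1# + 1#) ⁻¹
  ⅔ = (1# + 1#) * ⅓

record Graph (n : ℕ) : Set₁ where
  infix 4 _~_ _~?_
  field
    _~_      : Rel (Fin n) 0ℓ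
    _~?_     : Decidable _~_
    ~-sym    : Symmetric _~_
    ~-irrefl : Irreflexive _≡_ _~_

  -- Each edge {u, v} is listed exactly once, as the pair with u < v.
  edges : List (Fin n × Fin n)
  edges = filter (λ (u , v) → (u <ᶠ? v) ×-dec (u ~? v))
                 (cartesianProduct (allFin n) (allFin n))

module _ {n : ℕ} (G : Graph n) where
  open Graph G

  Connected : Set
  Connected = ∀ u v → Star _~_ u v

  Colourable : ℕ → Set
  Colourable k = Σ (Fin n → Fin k) λ c → ∀ {u v} → u ~ v → c u ≢ c v

  HasChromaticNumber : ℕ → Set
  HasChromaticNumber k = Colourable k × (∀ j → Colourable j → k ≤ⁿ j)

-- A map V_c → {0,1}; membership in a `Subset` is proof-irrelevant.
InitialColouring : ∀ {n} → Subset n → Set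
InitialColouring {n} Vc = (Σ (Fin n) λ v → v ∈ Vc) → Fin 2

ProperOn : ∀ {n} → Graph n → (Vc : Subset n) → InitialColouring Vc → Set
ProperOn G Vc g = ∀ {u v} (u∈ : u ∈ Vc) (v∈ : v ∈ Vc) → u ~ v → g (u , u∈) ≢ g (v , v∈)
  where open Graph G

module Contrast (ℝ : Reals) where
  open Reals ℝ
  open SetoidMembership setoid using () renaming (_∈_ to _∈ₗ_)

  ⟦_⟧ : Fin 2 → Carrier
  ⟦ zero ⟧     = 0#
  ⟦ suc zero ⟧ = 1#

  record IsGreyscale {n : ℕ} (f : Fin n → Carrier) : Set where
    field
      nonNeg : ∀ v → 0# ≤ f v
      ≤one   : ∀ v → f v ≤ 1#
      0∈Im   : ∃ λ v → f v ≈ 0#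
      1∈Im   : ∃ λ v → f v ≈ 1#

  contrastVector : ∀ {n} → Graph n → (Fin n → Carrier) → List Carrier
  contrastVector G f = sort (map (λ (u , v) → ∣ f u - f v ∣) (Graph.edges G))
    where open Sort decTotalOrder using (sort)

  infix 4 _≤ₗₑₓ_
  _≤ₗₑₓ_ : Rel (List Carrier) 0ℓ
  _≤ₗₑₓ_ = Lex-≤ _≈_ _≤_

  Compatible : ∀ {n} (Vc : Subset n) → InitialColouring Vc → (Fin n → Carrier) → Set
  Compatible Vc g f = ∀ {u} (u∈ : u ∈ Vc) → f u ≈ ⟦ g (u , u∈) ⟧

  record IsMaximumContrast {n : ℕ} (G : Graph n) (Vc : Subset n)
                           (g : InitialColouring Vc) (f : Fin n → Carrier) : Set where
    field
      isGreyscale : IsGreyscale f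
      compatible  : Compatible Vc g f
      maximal     : ∀ h → IsGreyscale h → Compatible Vc g h →
                    contrastVector G h ≤ₗₑₓ contrastVector G f

  Im_⊆_ : ∀ {n} → (Fin n → Carrier) → List Carrier → Set
  Im f ⊆ xs = ∀ v → f v ∈ₗ xs

{-# OPTIONS --safe #-}

-- A greyscale with all contrasts at least ⅓ exists: colour the free vertices
-- along the bipartition with ⅓ and ⅔, or with 0 and ⅔, or with 1 and ⅓,
-- depending on which of the values 0 and 1 occur on Vc.  Hence all contrasts
-- of the maximiser f are at least ⅓.  Let 0 < f v < 1 and let a be the least
-- contrast at v.  If no neighbour of v has value f v + a, then raising f v
-- slightly makes all contrasts at v exceed a and improves the contrast
-- vector; symmetrically for f v - a.  So v has neighbours with values f v ± a
-- where a ≥ ⅓, and all values of f lie in {0} ∪ [⅓,⅔] ∪ {1}.  If f v + a ≠ 1,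
-- then f v + a ≤ ⅔ gives f v = ⅓; if f v - a ≠ 0, then f v = ⅔; otherwise
-- f v = ½.

module Submission where

open import Defs
open import Algebra.Bundles using (CommutativeRing)
import Algebra.Properties.Ring as RingProperties
open import Data.Bool.Base using (if_then_else_)
open import Data.Nat.Base using (ℕ)
open import Data.Fin.Base using (Fin; zero; suc) renaming (_<_ to _<ᶠ_)
open import Data.Fin.Properties
  using (<-cmp; any?) renaming (_≟_ to _≟ᶠ_; _<?_ to _<ᶠ?_)
open import Data.Fin.Subset using (Subset; Nonempty; _⊂_; ⊤; _∈_; _∉_)
open import Data.Fin.Subset.Properties using (_∈?_)
open import Data.List.Base using ([]; _∷_; map; filter; tabulate; allFin; cartesianProduct)
import Data.List.Extrema as Extrema
import Data.List.Membership.Setoid as SetoidMembership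
open import Data.List.Membership.Propositional using (find) renaming (_∈_ to _∈ˡ_)
open import Data.List.Membership.Propositional.Properties
  using (∈-∃++; ∈-filter⁺; ∈-filter⁻; ∈-tabulate⁺; ∈-allFin; ∈-cartesianProduct⁺)
open import Data.List.Relation.Binary.Lex.NonStrict using (base; halt; this; next)
open import Data.List.Relation.Binary.Permutation.Propositional
  using (↭⇒↭ₛ) renaming (_↭_ to _↭ₚ_; ↭-sym to ↭ₚ-sym)
open import Data.List.Relation.Binary.Permutation.Propositional.Properties
  using () renaming (map⁺ to ↭ₚ-map⁺; ∈-resp-↭ to ∈-resp-↭ₚ; shift to ↭ₚ-shift)
import Data.List.Relation.Binary.Permutation.Homogeneous as Homogeneous
import Data.List.Relation.Binary.Permutation.Setoid as SetoidPermutation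
import Data.List.Relation.Binary.Permutation.Setoid.Properties as SetoidPermutationProperties
open import Data.List.Relation.Unary.All as All using ()
open import Data.List.Relation.Unary.All.Properties using (all-filter)
open import Data.List.Relation.Unary.Any as Any using (here; there)
import Data.List.Relation.Unary.Any.Properties as Any
open import Data.List.Relation.Unary.Linked as Linked using ()
open import Data.List.Relation.Unary.Linked.Properties using (Linked⇒All)
import Data.List.Relation.Unary.Sorted.TotalOrder as SortedTotalOrder
import Data.List.Sort as Sort
open import Data.Product.Base using (∃; _×_; _,_; proj₁; proj₂)
open import Data.Sum.Base using (_⊎_; inj₁; inj₂; [_,_]′)
open import Data.Vec.Functional using (updateAt)
open import Data.Vec.Functional.Properties using (updateAt-updates; updateAt-minimal)
open import Function.Base using (_∘_; id; const)
open import Relation.Binary.Bundles using (DecTotalOrder; StrictTotalOrder)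
open import Relation.Binary.Construct.Closure.ReflexiveTransitive using (ε; _◅_)
open import Relation.Binary.Definitions using (tri<; tri≈; tri>)
import Relation.Binary.Properties.DecTotalOrder as DecTotalOrderProperties
import Relation.Binary.Properties.TotalOrder as TotalOrderProperties
import Relation.Binary.Reasoning.PartialOrder as PartialOrderReasoning
open import Relation.Binary.PropositionalEquality as ≡ using (_≡_; _≢_; refl)
open import Relation.Nullary.Decidable using (Dec; yes; no; does; _×-dec_; decidable-stable)
open import Relation.Nullary.Negation using (¬_; contradiction)

-- Ordered-field arithmetic.

module RealProperties (ℝ : Reals) where
  open Reals ℝ

  commutativeRing : CommutativeRing _ _
  commutativeRing = record { isCommutativeRing = isCommutativeRing }

  open CommutativeRing commutativeRing public
    using ( +-cong; +-congˡ; +-congʳ; +-comm; +-assoc; +-identityˡ; +-identityʳ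
          ; -‿inverseˡ; -‿inverseʳ; -‿cong; *-congʳ; *-comm
          ; *-identityˡ; distribʳ; ring )
  open RingProperties ring public
    using (-‿involutive; -‿+-comm; -1*x≈-x)
  open DecTotalOrder decTotalOrder public
    using (antisym; total; totalOrder; poset; ≤-respˡ-≈; ≤-respʳ-≈; _≟_)
    renaming (refl to ≤-refl; reflexive to ≤-reflexive; trans to ≤-trans; module Eq to ≈)
  open DecTotalOrderProperties decTotalOrder public
    using (_<_; <-strictTotalOrder; <-respʳ-≈; ≤∧≉⇒<; <⇒≱)
  open TotalOrderProperties totalOrder public using (≰⇒>)
  open StrictTotalOrder <-strictTotalOrder public using (_<?_)
  module ≤-Reasoning = PartialOrderReasoning poset

  <⇒≤ : ∀ {x y} → x < y → x ≤ y
  <⇒≤ = proj₁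

  ≮⇒≥ : ∀ {x y} → ¬ (x < y) → y ≤ x
  ≮⇒≥ {x} {y} x≮y with y ≤? x
  ... | yes y≤x = y≤x
  ... | no  y≰x = contradiction (≰⇒> y≰x) x≮y

  <-≤-trans : ∀ {x y z} → x < y → y ≤ z → x < z
  <-≤-trans x<y y≤z = ≰⇒> λ z≤x → <⇒≱ x<y (≤-trans y≤z z≤x)

  ≤-<-trans : ∀ {x y z} → x ≤ y → y < z → x < z
  ≤-<-trans x≤y y<z = ≰⇒> λ z≤x → <⇒≱ y<z (≤-trans z≤x x≤y)

  +-monoʳ-≤ : ∀ z {x y} → x ≤ y → z + x ≤ z + y
  +-monoʳ-≤ z {x} {y} x≤y = begin
    z + x ≈⟨ +-comm z x ⟩
    x + z ≤⟨ +-monoˡ-≤ z x≤y ⟩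
    y + z ≈⟨ +-comm y z ⟩
    z + y ∎
    where open ≤-Reasoning

  +-mono-≤ : ∀ {x y u v} → x ≤ y → u ≤ v → x + u ≤ y + v
  +-mono-≤ {y = y} {u} x≤y u≤v = ≤-trans (+-monoˡ-≤ u x≤y) (+-monoʳ-≤ y u≤v)

  x+y-y≈x : ∀ x y → (x + y) - y ≈ x
  x+y-y≈x x y = ≈.trans (+-assoc x y (- y)) (≈.trans (+-congˡ (-‿inverseʳ y)) (+-identityʳ x))

  x-y+y≈x : ∀ x y → (x - y) + y ≈ x
  x-y+y≈x x y = ≈.trans (+-assoc x (- y) y) (≈.trans (+-congˡ (-‿inverseˡ y)) (+-identityʳ x))

  +-cancelʳ-≤ : ∀ z {x y} → x + z ≤ y + z → x ≤ y
  +-cancelʳ-≤ z {x} {y} p = begin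
    x           ≈⟨ x+y-y≈x x z ⟨
    (x + z) - z ≤⟨ +-monoˡ-≤ (- z) p ⟩
    (y + z) - z ≈⟨ x+y-y≈x y z ⟩
    y           ∎
    where open ≤-Reasoning

  +-cancelˡ-≤ : ∀ z {x y} → z + x ≤ z + y → x ≤ y
  +-cancelˡ-≤ z {x} {y} p =
    +-cancelʳ-≤ z (≤-respˡ-≈ (+-comm z x) (≤-respʳ-≈ (+-comm z y) p))

  +-monoˡ-< : ∀ z {x y} → x < y → x + z < y + z
  +-monoˡ-< z x<y = ≰⇒> (<⇒≱ x<y ∘ +-cancelʳ-≤ z)

  +-cancelʳ-< : ∀ z {x y} → x + z < y + z → x < y
  +-cancelʳ-< z p = ≰⇒> (<⇒≱ p ∘ +-monoˡ-≤ z)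

  y+z≤x⇒z≤x-y : ∀ {x y z} → y + z ≤ x → z ≤ x - y
  y+z≤x⇒z≤x-y {x} {y} {z} p = +-cancelʳ-≤ y (begin
    z + y       ≈⟨ +-comm z y ⟩
    y + z       ≤⟨ p ⟩
    x           ≈⟨ x-y+y≈x x y ⟨
    (x - y) + y ∎)
    where open ≤-Reasoning

  z≤x-y⇒y+z≤x : ∀ {x y z} → z ≤ x - y → y + z ≤ x
  z≤x-y⇒y+z≤x {x} {y} {z} p = begin
    y + z       ≈⟨ +-comm y z ⟩
    z + y       ≤⟨ +-monoˡ-≤ y p ⟩
    (x - y) + y ≈⟨ x-y+y≈x x y ⟩
    x           ∎
    where open ≤-Reasoning

  z≈x-y⇒y+z≈x : ∀ {x y z} → z ≈ x - y → y + z ≈ x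
  z≈x-y⇒y+z≈x {x} {y} {z} p = ≈.trans (+-comm y z) (≈.trans (+-congʳ p) (x-y+y≈x x y))

  -[x-y]≈y-x : ∀ x y → - (x - y) ≈ y - x
  -[x-y]≈y-x x y = ≈.trans (≈.sym (-‿+-comm x (- y)))
                  (≈.trans (+-congˡ (-‿involutive y)) (+-comm (- x) y))

  0≤⇒-≤0 : ∀ {x} → 0# ≤ x → - x ≤ 0#
  0≤⇒-≤0 {x} 0≤x = +-cancelʳ-≤ x (begin
    - x + x ≈⟨ -‿inverseˡ x ⟩
    0#      ≤⟨ 0≤x ⟩
    x       ≈⟨ +-identityˡ x ⟨
    0# + x  ∎)
    where open ≤-Reasoning

  -- If 1 ≤ 0, then 0 ≤ (-1)(-1) = 1.
  0<1 : 0# < 1#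
  0<1 = ≤∧≉⇒< 0≤1 0≉1
    where
    0≤1 : 0# ≤ 1#
    0≤1 with total 0# 1#
    ... | inj₁ p = p
    ... | inj₂ p = ≤-respʳ-≈ (≈.trans (-1*x≈-x _) (-‿involutive 1#)) (*-nonNeg 0≤-1 0≤-1)
      where
      0≤-1 : 0# ≤ - 1#
      0≤-1 = ≤-respʳ-≈ (+-identityˡ _) (y+z≤x⇒z≤x-y (≤-respˡ-≈ (≈.sym (+-identityʳ _)) p))

  0<+ : ∀ {x y} → 0# < x → 0# < y → 0# < x + y
  0<+ {x} {y} 0<x 0<y = begin-strict
    0#     <⟨ 0<y ⟩
    y      ≈⟨ +-identityˡ y ⟨
    0# + y <⟨ +-monoˡ-< y 0<x ⟩
    x + y  ∎
    where open ≤-Reasoning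

  -- Halves and thirds.

  ½+½≈1 : ½ + ½ ≈ 1#
  ½+½≈1 = begin-equality
    ½ + ½           ≈⟨ +-cong (*-identityˡ ½) (*-identityˡ ½) ⟨
    1# * ½ + 1# * ½ ≈⟨ distribʳ ½ 1# 1# ⟨
    (1# + 1#) * ½   ≈⟨ ⁻¹-inverseʳ _ (proj₂ (0<+ 0<1 0<1) ∘ ≈.sym) ⟩
    1#              ∎
    where open ≤-Reasoning

  ⅔≈⅓+⅓ : ⅔ ≈ ⅓ + ⅓
  ⅔≈⅓+⅓ = ≈.trans (distribʳ ⅓ 1# 1#) (+-cong (*-identityˡ ⅓) (*-identityˡ ⅓))

  ⅔+⅓≈1 : ⅔ + ⅓ ≈ 1#
  ⅔+⅓≈1 = begin-equality
    ⅔ + ⅓                   ≈⟨ +-congˡ (*-identityˡ ⅓) ⟨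
    (1# + 1#) * ⅓ + 1# * ⅓  ≈⟨ distribʳ ⅓ (1# + 1#) 1# ⟨
    (1# + 1# + 1#) * ⅓      ≈⟨ ⁻¹-inverseʳ _ (proj₂ (0<+ (0<+ 0<1 0<1) 0<1) ∘ ≈.sym) ⟩
    1#                      ∎
    where open ≤-Reasoning

  -- Otherwise three summands that are at most 0 would add up to 1.
  0<⅓ : 0# < ⅓
  0<⅓ = ≰⇒> λ ⅓≤0 → <⇒≱ 0<1 (begin
    1#             ≈⟨ ⅔+⅓≈1 ⟨
    ⅔ + ⅓          ≈⟨ +-congʳ ⅔≈⅓+⅓ ⟩
    ⅓ + ⅓ + ⅓      ≤⟨ +-mono-≤ (+-mono-≤ ⅓≤0 ⅓≤0) ⅓≤0 ⟩
    0# + 0# + 0#   ≈⟨ ≈.trans (+-identityʳ _) (+-identityʳ _) ⟩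
    0#             ∎)
    where open ≤-Reasoning

  ≤+⅓ : ∀ x → x ≤ x + ⅓
  ≤+⅓ x = ≤-respˡ-≈ (+-identityʳ x) (+-monoʳ-≤ x (<⇒≤ 0<⅓))

  0≤1 : 0# ≤ 1#
  0≤1 = <⇒≤ 0<1

  0≤⅓ : 0# ≤ ⅓
  0≤⅓ = <⇒≤ 0<⅓

  ⅓≤⅔ : ⅓ ≤ ⅔
  ⅓≤⅔ = ≤-respʳ-≈ (≈.sym ⅔≈⅓+⅓) (≤+⅓ ⅓)

  ⅔≤1 : ⅔ ≤ 1#
  ⅔≤1 = ≤-respʳ-≈ ⅔+⅓≈1 (≤+⅓ ⅔)

  0≤⅔ : 0# ≤ ⅔
  0≤⅔ = ≤-trans 0≤⅓ ⅓≤⅔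

  ⅓≤1 : ⅓ ≤ 1#
  ⅓≤1 = ≤-trans ⅓≤⅔ ⅔≤1

  0+⅓≤⅓ : 0# + ⅓ ≤ ⅓
  0+⅓≤⅓ = ≤-reflexive (+-identityˡ ⅓)

  0+⅓≤⅔ : 0# + ⅓ ≤ ⅔
  0+⅓≤⅔ = ≤-trans 0+⅓≤⅓ ⅓≤⅔

  0+⅓≤1 : 0# + ⅓ ≤ 1#
  0+⅓≤1 = ≤-trans 0+⅓≤⅓ ⅓≤1

  ⅓+⅓≤⅔ : ⅓ + ⅓ ≤ ⅔
  ⅓+⅓≤⅔ = ≤-reflexive (≈.sym ⅔≈⅓+⅓)

  ⅓+⅓≤1 : ⅓ + ⅓ ≤ 1#
  ⅓+⅓≤1 = ≤-trans ⅓+⅓≤⅔ ⅔≤1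

  ⅔+⅓≤1 : ⅔ + ⅓ ≤ 1#
  ⅔+⅓≤1 = ≤-reflexive ⅔+⅓≈1

  double-half : ∀ x → (x + x) * ½ ≈ x
  double-half x = begin-equality
    (x + x) * ½   ≈⟨ distribʳ ½ x x ⟩
    x * ½ + x * ½ ≈⟨ +-cong (*-comm x ½) (*-comm x ½) ⟩
    ½ * x + ½ * x ≈⟨ distribʳ x ½ ½ ⟨
    (½ + ½) * x   ≈⟨ *-congʳ ½+½≈1 ⟩
    1# * x        ≈⟨ *-identityˡ x ⟩
    x             ∎
    where open ≤-Reasoning

  half-double : ∀ x → x * ½ + x * ½ ≈ x
  half-double x = ≈.trans (≈.sym (distribʳ ½ x x)) (double-half x)

  x+x≈1⇒x≈½ : ∀ {x} → x + x ≈ 1# → x ≈ ½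
  x+x≈1⇒x≈½ {x} p = ≈.trans (≈.sym (double-half x)) (≈.trans (*-congʳ p) (*-identityˡ ½))

  dense : ∀ {x y} → x < y → ∃ λ m → x < m × m < y
  dense {x} {y} x<y = m , x<m , m<y
    where
    m = (x + y) * ½
    m+m≈x+y : m + m ≈ x + y
    m+m≈x+y = half-double (x + y)
    x<m : x < m
    x<m = ≰⇒> λ m≤x → <⇒≱ x<y
      (+-cancelˡ-≤ x (≤-respˡ-≈ m+m≈x+y (+-mono-≤ m≤x m≤x)))
    m<y : m < y
    m<y = ≰⇒> λ y≤m → <⇒≱ x<y
      (+-cancelʳ-≤ y (≤-respʳ-≈ m+m≈x+y (+-mono-≤ y≤m y≤m)))

  -- Absolute value and distance.

  x≤∣x∣ : ∀ x → x ≤ ∣ x ∣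
  x≤∣x∣ x with 0# ≤? x
  ... | yes _   = ≤-refl
  ... | no  0≰x = ≤-trans (<⇒≤ (≰⇒> 0≰x))
    (≤-respʳ-≈ (+-identityˡ _)
      (y+z≤x⇒z≤x-y (≤-respˡ-≈ (≈.sym (+-identityʳ _)) (<⇒≤ (≰⇒> 0≰x)))))

  -x≤∣x∣ : ∀ x → - x ≤ ∣ x ∣
  -x≤∣x∣ x with 0# ≤? x
  ... | yes 0≤x = ≤-trans (0≤⇒-≤0 0≤x) 0≤x
  ... | no  _   = ≤-refl

  -- Together with `x≤∣x∣` and `-x≤∣x∣` this makes `∣ x ∣` the least upper bound of `x` and `- x`,
  -- so congruence and evenness follow by antisymmetry.
  ∣∣-least : ∀ {x m} → x ≤ m → - x ≤ m → ∣ x ∣ ≤ m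
  ∣∣-least {x} x≤m -x≤m with 0# ≤? x
  ... | yes _ = x≤m
  ... | no  _ = -x≤m

  ∣-∣-cong : ∀ {x y} → x ≈ y → ∣ x ∣ ≈ ∣ y ∣
  ∣-∣-cong x≈y = antisym (∣∣-mono x≈y) (∣∣-mono (≈.sym x≈y))
    where
    ∣∣-mono : ∀ {x y} → x ≈ y → ∣ x ∣ ≤ ∣ y ∣
    ∣∣-mono x≈y = ∣∣-least (≤-respˡ-≈ (≈.sym x≈y) (x≤∣x∣ _))
                           (≤-respˡ-≈ (-‿cong (≈.sym x≈y)) (-x≤∣x∣ _))

  ∣-x∣≈∣x∣ : ∀ x → ∣ - x ∣ ≈ ∣ x ∣
  ∣-x∣≈∣x∣ x = antisym
    (∣∣-least (-x≤∣x∣ x) (≤-respˡ-≈ (≈.sym (-‿involutive x)) (x≤∣x∣ x)))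
    (∣∣-least (≤-respˡ-≈ (-‿involutive x) (-x≤∣x∣ (- x))) (x≤∣x∣ (- x)))

  dist : Carrier → Carrier → Carrier
  dist x y = ∣ x - y ∣

  dist-cong : ∀ {x y u v} → x ≈ y → u ≈ v → dist x u ≈ dist y v
  dist-cong x≈y u≈v = ∣-∣-cong (+-cong x≈y (-‿cong u≈v))

  dist-sym : ∀ x y → dist x y ≈ dist y x
  dist-sym x y = ≈.trans (≈.sym (∣-x∣≈∣x∣ _)) (∣-∣-cong (-[x-y]≈y-x x y))

  dist-neg : ∀ x y → dist (- x) (- y) ≈ dist x y
  dist-neg x y = ≈.trans (∣-∣-cong (-‿+-comm x (- y))) (∣-x∣≈∣x∣ _)

  ≤-dist⁺ : ∀ {x y a} → y + a ≤ x → a ≤ dist x y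
  ≤-dist⁺ p = ≤-trans (y+z≤x⇒z≤x-y p) (x≤∣x∣ _)

  <-dist⁺ : ∀ {x y a} → y + a < x → a < dist x y
  <-dist⁺ {x} {y} p = ≰⇒> λ d≤a → <⇒≱ p
    (≤-respˡ-≈ (z≈x-y⇒y+z≈x ≈.refl) (+-monoʳ-≤ y (≤-trans (x≤∣x∣ (x - y)) d≤a)))

  ≤-dist⁺ʳ : ∀ {x y a} → x + a ≤ y → a ≤ dist x y
  ≤-dist⁺ʳ p = ≤-respʳ-≈ (dist-sym _ _) (≤-dist⁺ p)

  ≤-dist⁻ : ∀ {x y a} → a ≤ dist x y → y + a ≤ x ⊎ x + a ≤ y
  ≤-dist⁻ {x} {y} p with 0# ≤? x - y
  ... | yes _ = inj₁ (z≤x-y⇒y+z≤x p)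
  ... | no  _ = inj₂ (z≤x-y⇒y+z≤x (≤-respʳ-≈ (-[x-y]≈y-x x y) p))

  -- Moving a number away from finitely many others.

  open Extrema totalOrder using (min; min≤⊤; min≤xs; argmin-all)

  -- Take the minimum of `b` and the finitely many values of `φ` above `t`. This leaves a gap above
  -- `t` that contains no value of `φ`.
  lowerBoundAbove : ∀ {n} (φ : Fin n → Carrier) {t b} → t < b →
                    ∃ λ s → t < s × s ≤ b × (∀ w → t < φ w → s ≤ φ w)
  lowerBoundAbove φ {t} {b} t<b =
    min b above , argmin-all id t<b (all-filter (t <?_) (tabulate φ)) , min≤⊤ b above ,
    λ w t<φw → All.lookup (min≤xs b above) (∈-filter⁺ (t <?_) (∈-tabulate⁺ w) t<φw)
    where above = filter (t <?_) (tabulate φ)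

  -- On `P`, each value of `φ` is at most `x - a` or strictly above `x + a`. Raising `x` leaves the
  -- former further behind. If `x + a` is raised only to a point `m` inside the gap above it, the
  -- latter stay more than `a` away. Capping the gap at `b + a` keeps the new number `m - a` below
  -- `b`.
  moveUp : ∀ {n} (P : Fin n → Set) (φ : Fin n → Carrier) {x a b} → x < b →
           (∀ {w} → P w → a ≤ dist x (φ w)) → (∀ {w} → P w → ¬ (x + a ≈ φ w)) →
           ∃ λ y → x ≤ y × y ≤ b × (∀ {w} → P w → a < dist y (φ w))
  moveUp P φ {x} {a} {b} x<b far unmet
    with s , x+a<s , s≤b+a , bound ← lowerBoundAbove φ (+-monoˡ-< a x<b)
    with m , x+a<m , m<s ← dense x+a<s
    = y , <⇒≤ x<y , +-cancelʳ-≤ a (≤-respˡ-≈ (≈.sym y+a≈m) (≤-trans (<⇒≤ m<s) s≤b+a)) , far′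
    where
    y = m - a
    y+a≈m : y + a ≈ m
    y+a≈m = x-y+y≈x m a
    x<y : x < y
    x<y = +-cancelʳ-< a (<-respʳ-≈ (≈.sym y+a≈m) x+a<m)
    far′ : ∀ {w} → P w → a < dist y (φ w)
    far′ {w} Pw with ≤-dist⁻ (far Pw)
    ... | inj₁ φw+a≤x = <-dist⁺ (begin-strict
      φ w + a ≤⟨ φw+a≤x ⟩
      x       <⟨ x<y ⟩
      y       ∎)
      where open ≤-Reasoning
    ... | inj₂ x+a≤φw = <-respʳ-≈ (dist-sym (φ w) y) (<-dist⁺ (begin-strict
      y + a ≈⟨ y+a≈m ⟩
      m     <⟨ m<s ⟩
      s     ≤⟨ bound w (≤∧≉⇒< x+a≤φw (unmet Pw)) ⟩
      φ w   ∎))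
      where open ≤-Reasoning

  neg-mono : ∀ {x y} → x ≤ y → - y ≤ - x
  neg-mono {x} {y} x≤y = ≤-respʳ-≈ (+-identityˡ _) (y+z≤x⇒z≤x-y (begin
    x - y ≤⟨ +-monoˡ-≤ (- y) x≤y ⟩
    y - y ≈⟨ -‿inverseʳ y ⟩
    0#    ∎))
    where open ≤-Reasoning

  -‿selfInverse-≤ : ∀ {x y} → - x ≤ y → - y ≤ x
  -‿selfInverse-≤ {x} p = ≤-respʳ-≈ (-‿involutive x) (neg-mono p)

  neg-mono-< : ∀ {x y} → x < y → - y < - x
  neg-mono-< {x} {y} x<y = ≰⇒> λ -x≤-y →
    <⇒≱ x<y (≤-respˡ-≈ (-‿involutive y) (-‿selfInverse-≤ -x≤-y))

  -x+a≈-y⇒y+a≈x : ∀ {x y a} → - x + a ≈ - y → y + a ≈ x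
  -x+a≈-y⇒y+a≈x {x} {y} {a} p = z≈x-y⇒y+z≈x (begin-equality
    a             ≈⟨ x+y-y≈x a (- x) ⟨
    a - x - - x   ≈⟨ +-cong (≈.trans (+-comm a (- x)) p) (-‿involutive x) ⟩
    - y + x       ≈⟨ +-comm (- y) x ⟩
    x - y         ∎)
    where open ≤-Reasoning

  -- Apply `moveUp` after negating everything, which preserves distances and reverses the order.
  moveDown : ∀ {n} (P : Fin n → Set) (φ : Fin n → Carrier) {x a b} → b < x →
             (∀ {w} → P w → a ≤ dist x (φ w)) → (∀ {w} → P w → ¬ (φ w + a ≈ x)) →
             ∃ λ y → y ≤ x × b ≤ y × (∀ {w} → P w → a < dist y (φ w))
  moveDown P φ {x} {a} {b} b<x far unmet =
    let y , -x≤y , y≤-b , far′ = moveUp P (-_ ∘ φ) (neg-mono-< b<x)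
           (λ Pw → ≤-respʳ-≈ (≈.sym (dist-neg x _)) (far Pw))
           (λ Pw → unmet Pw ∘ -x+a≈-y⇒y+a≈x)
    in - y , -‿selfInverse-≤ -x≤y , ≤-respˡ-≈ (-‿involutive b) (neg-mono y≤-b) ,
       λ Pw → <-respʳ-≈ (≈.trans (≈.sym (dist-neg y _)) (dist-cong ≈.refl (-‿involutive _)))
                        (far′ Pw)

-- Lexicographic comparison of sorted contrast lists.

module ContrastImprovement (ℝ : Reals) where
  open Reals ℝ hiding (_≤?_)
  open RealProperties ℝ
  open Contrast ℝ
  open SetoidPermutation setoid using (_↭_; prep; ↭-refl; ↭-sym; ↭-trans)
  open SetoidPermutationProperties setoid using (∈-resp-↭; drop-∷)
  open SetoidMembership setoid using () renaming (_∈_ to _∈ₗ_)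
  open SortedTotalOrder totalOrder using (Sorted)
  open Sort decTotalOrder using (sort-↭; sort-↗)
  open Extrema totalOrder using (argmin; argmin-all; f[argmin]≤f[⊤]; f[argmin]≤f[xs])

  -- Sorting permutes up to `_≡_`, but entries of two contrast lists can be matched and cancelled
  -- only up to `_≈_`.
  ↭ₚ⇒↭ : ∀ {xs ys} → xs ↭ₚ ys → xs ↭ ys
  ↭ₚ⇒↭ = Homogeneous.map ≈.reflexive ∘ ↭⇒↭ₛ

  head≤ : ∀ {x xs z} → Sorted (x ∷ xs) → z ∈ₗ (x ∷ xs) → x ≤ z
  head≤ sorted = All.lookupₛ setoid ≤-respʳ-≈ (Linked⇒All ≤-trans ≤-refl sorted)

  module _ {A : Set} where

    image∈ : ∀ (r : A → Carrier) {xs E e} → xs ↭ map r E → e ∈ˡ E → r e ∈ₗ xs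
    image∈ r xs↭ e∈E = ∈-resp-↭ (↭-sym xs↭) (Any.map⁺ (Any.map (λ { refl → ≈.refl }) e∈E))

    extract : ∀ {e : A} {E} → e ∈ˡ E → ∃ λ E′ → E ↭ₚ e ∷ E′
    extract e∈E with ws , vs , refl ← ∈-∃++ e∈E = _ , ↭ₚ-shift _ ws vs

    dropImage : ∀ (r : A → Carrier) {x xs E e E′} → x ∷ xs ↭ map r E →
                E ↭ₚ e ∷ E′ → x ≈ r e → xs ↭ map r E′
    dropImage r xs↭ E↭ x≈re = drop-∷ (↭-trans xs↭ (↭-trans
      (↭ₚ⇒↭ (↭ₚ-map⁺ r E↭)) (prep (≈.sym x≈re) ↭-refl)))

    module _ (p q : A → Carrier) (a : Carrier) where

      -- An entry that changes starts at `a` or above and ends strictly above `a`. So the entries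
      -- below the threshold stay as they are, and no new entry appears at it.
      KeptOrRaised : A → Set
      KeptOrRaised e = p e ≈ q e ⊎ (a ≤ p e × a < q e)

      -- If the heads x of xs and y of ys satisfy y ≤ x, then y ≤ a, so y = q e
      -- for some e with p e ≈ q e; hence y ≈ x and e can be cancelled.
      sorted-raised-≰ : ∀ {xs ys E} → Sorted xs → Sorted ys →
                        xs ↭ map p E → ys ↭ map q E →
                        (∀ {e} → e ∈ˡ E → KeptOrRaised e) →
                        (∃ λ e → e ∈ˡ E × p e ≤ a × a < q e) → ¬ (ys ≤ₗₑₓ xs)
      -- Neither list is empty, because `e₀` contributes an entry to both.
      sorted-raised-≰ _ _ xs↭ _ _ (_ , e₀∈E , _) (base _) with () ← image∈ p xs↭ e₀∈E
      sorted-raised-≰ _ _ _ ys↭ _ (_ , e₀∈E , _) halt     with () ← image∈ q ys↭ e₀∈E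
      sorted-raised-≰ {x ∷ xs} {y ∷ ys} {E} xs↗ ys↗ xs↭ ys↭ kept (e₀ , e₀∈E , pe₀≤a , a<qe₀) lex
        with e , e∈E , y≈qe ← find (Any.map⁻ (∈-resp-↭ ys↭ (here ≈.refl)))
        = cancel (kept e∈E) lex
        where
        x≤a : x ≤ a
        x≤a = ≤-trans (head≤ xs↗ (image∈ p xs↭ e₀∈E)) pe₀≤a
        cancel : KeptOrRaised e → ¬ ((y ∷ ys) ≤ₗₑₓ (x ∷ xs))
        cancel (inj₂ (_ , a<qe)) (this y<x) =
          <⇒≱ a<qe (≤-respˡ-≈ y≈qe (≤-trans (<⇒≤ y<x) x≤a))
        cancel (inj₂ (_ , a<qe)) (next y≈x _) =
          <⇒≱ a<qe (≤-respˡ-≈ (≈.trans (≈.sym y≈x) y≈qe) x≤a)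
        cancel (inj₁ pe≈qe) (this y<x) =
          <⇒≱ y<x (≤-respʳ-≈ (≈.trans pe≈qe (≈.sym y≈qe)) (head≤ xs↗ (image∈ p xs↭ e∈E)))
        cancel (inj₁ pe≈qe) (next y≈x lex′) with E′ , E↭ ← extract e∈E =
          sorted-raised-≰ (Linked.tail xs↗) (Linked.tail ys↗)
            (dropImage p xs↭ E↭ (≈.trans (≈.sym y≈x) (≈.trans y≈qe (≈.sym pe≈qe))))
            (dropImage q ys↭ E↭ y≈qe)
            (λ e′∈E′ → kept (∈-resp-↭ₚ (↭ₚ-sym E↭) (there e′∈E′)))
            (e₀ , e₀∈ (∈-resp-↭ₚ E↭ e₀∈E) , pe₀≤a , a<qe₀) lex′
          where
          -- The raised entry survives the cancellation: `e` has equal values under `p` and `q`,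
          -- while those of `e₀` are separated by `a`.
          e₀∈ : ∀ {E′} → e₀ ∈ˡ e ∷ E′ → e₀ ∈ˡ E′
          e₀∈ (there i)   = i
          e₀∈ (here refl) =
            contradiction (≤-respˡ-≈ pe≈qe pe₀≤a) (<⇒≱ a<qe₀)

  -- Adjacency and the list of edges.

  module _ {n : ℕ} (G : Graph n) where
    open Graph G

    ∈edges⇒~ : ∀ {u v} → (u , v) ∈ˡ edges → u ~ v
    ∈edges⇒~ = proj₂ ∘ proj₂ ∘ ∈-filter⁻ (λ (u , v) → (u <ᶠ? v) ×-dec (u ~? v))
      {xs = cartesianProduct (allFin n) (allFin n)}

    ordered∈edges : ∀ {u v} → u <ᶠ v → u ~ v → (u , v) ∈ˡ edges
    ordered∈edges {u} {v} u<v u~v = ∈-filter⁺ (λ (u , v) → (u <ᶠ? v) ×-dec (u ~? v))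
      (∈-cartesianProduct⁺ (∈-allFin u) (∈-allFin v)) (u<v , u~v)

    ~⇒∈edges : ∀ {u v} → u ~ v → (u , v) ∈ˡ edges ⊎ (v , u) ∈ˡ edges
    ~⇒∈edges {u} {v} u~v with <-cmp u v
    ... | tri< u<v _ _  = inj₁ (ordered∈edges u<v u~v)
    ... | tri≈ _ u≡v _  = contradiction u~v (~-irrefl u≡v)
    ... | tri> _ _ v<u  = inj₂ (ordered∈edges v<u (~-sym u~v))

  Apart : Carrier → Carrier → Set
  Apart x y = ⅓ ≤ dist x y

  apart-⟦⟧ : ∀ {i j} → i ≢ j → Apart ⟦ i ⟧ ⟦ j ⟧
  apart-⟦⟧ {zero}     {zero}     i≢j = contradiction refl i≢j
  apart-⟦⟧ {zero}     {suc zero} _   = ≤-dist⁺ʳ 0+⅓≤1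
  apart-⟦⟧ {suc zero} {zero}     _   = ≤-dist⁺ 0+⅓≤1
  apart-⟦⟧ {suc zero} {suc zero} i≢j = contradiction refl i≢j

  apart-sym : ∀ {x y} → Apart x y → Apart y x
  apart-sym = ≤-respʳ-≈ (dist-sym _ _)

  apart-resp : ∀ {x y u v} → x ≈ y → u ≈ v → Apart y v → Apart x u
  apart-resp x≈y u≈v = ≤-respʳ-≈ (dist-cong (≈.sym x≈y) (≈.sym u≈v))

  apart-respˡ : ∀ {x y u} → x ≈ y → Apart y u → Apart x u
  apart-respˡ x≈y = apart-resp x≈y ≈.refl

  -- Consequences of maximality.

  module _ {n : ℕ} {G : Graph n} {Vc : Subset n} {g : InitialColouring Vc}
           {f : Fin n → Carrier} (max : IsMaximumContrast G Vc g f) where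
    open Graph G
    open IsMaximumContrast max

    contrast : (Fin n → Carrier) → Fin n × Fin n → Carrier
    contrast h (u , v) = dist (h u) (h v)

    -- An edge lifted from at most `a` to above `a`, with all others kept or raised, would make the
    -- contrast vector of `h` beat that of `f` by `sorted-raised-≰`.
    not-improvable : ∀ {h a} → IsGreyscale h → Compatible Vc g h →
      (∀ {u v} → u ~ v → KeptOrRaised (contrast f) (contrast h) a (u , v)) →
      ∀ {u v} → u ~ v → contrast f (u , v) ≤ a → ¬ (a < contrast h (u , v))
    not-improvable {h} {a} grey comp kept {u} {v} u~v d≤a a<d =
      sorted-raised-≰ (contrast f) (contrast h) a (sort-↗ _) (sort-↗ _)
        (↭ₚ⇒↭ (sort-↭ _)) (↭ₚ⇒↭ (sort-↭ _)) (kept ∘ ∈edges⇒~ G)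
        -- The edge is listed in one orientation only; contrasts are symmetric.
        ([ (λ uv∈ → (u , v) , uv∈ , d≤a , a<d)
         , (λ vu∈ → (v , u) , vu∈ , ≤-respˡ-≈ (dist-sym (f u) (f v)) d≤a ,
                                    <-respʳ-≈ (dist-sym (h u) (h v)) a<d)
         ]′ (~⇒∈edges G u~v))
        (maximal h grey comp)

    -- Suppose an edge of `f` had contrast below `b`, and take the least contrast of `f` as
    -- threshold. It is below `b`, so under `h` every edge lies strictly above it, and `h` would
    -- improve on `f`.
    contrast-bound : ∀ {h b} → IsGreyscale h → Compatible Vc g h →
      (∀ {u v} → u ~ v → b ≤ contrast h (u , v)) →
      ∀ {u v} → u ~ v → b ≤ contrast f (u , v)
    contrast-bound {h} {b} grey comp b≤h =
      λ u~v → [ bound , ≤-respʳ-≈ (dist-sym _ _) ∘ bound ]′ (~⇒∈edges G u~v)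
      where
      bound : ∀ {e} → e ∈ˡ edges → b ≤ contrast f e
      bound {e} e∈ = ≮⇒≥ λ e<b →
        let a<b = ≤-<-trans (f[argmin]≤f[⊤] {f = contrast f} e edges) e<b in
        not-improvable grey comp
          (λ u~v → inj₂ (least u~v , <-≤-trans a<b (b≤h u~v)))
          (∈edges⇒~ G e₁∈) ≤-refl (<-≤-trans a<b (b≤h (∈edges⇒~ G e₁∈)))
        where
        e₁ = argmin (contrast f) e edges
        e₁∈ : e₁ ∈ˡ edges
        e₁∈ = argmin-all (contrast f) e∈ (All.tabulate id)
        least : ∀ {u v} → u ~ v → contrast f e₁ ≤ contrast f (u , v)
        least u~v = [ below , ≤-respʳ-≈ (dist-sym _ _) ∘ below ]′ (~⇒∈edges G u~v)
          where
          below : ∀ {e′} → e′ ∈ˡ edges → contrast f e₁ ≤ contrast f e′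
          below = All.lookup (f[argmin]≤f[xs] {f = contrast f} e edges)

    -- The vertices at which `f` attains 0 and 1 differ from `v`, so they still attain them after
    -- the change.
    greyscaleMove : ∀ {v y} → ¬ (f v ≈ 0#) → ¬ (f v ≈ 1#) → 0# ≤ y → y ≤ 1# →
                    IsGreyscale (updateAt f v (const y))
    greyscaleMove {v} {y} fv≉0 fv≉1 0≤y y≤1 = record
      { nonNeg = λ w → everywhere (0# ≤_) 0≤y nonNeg w
      ; ≤one   = λ w → everywhere (_≤ 1#) y≤1 ≤one w
      ; 0∈Im   = keep fv≉0 0∈Im
      ; 1∈Im   = keep fv≉1 1∈Im
      }
      where
      open IsGreyscale isGreyscale
      everywhere : ∀ (P : Carrier → Set) → P y → (∀ w → P (f w)) →
                   ∀ w → P (updateAt f v (const y) w)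
      everywhere P Py Pf w with w ≟ᶠ v
      ... | yes refl = ≡.subst P (≡.sym (updateAt-updates v f)) Py
      ... | no  w≢v  = ≡.subst P (≡.sym (updateAt-minimal w v f w≢v)) (Pf w)
      keep : ∀ {b} → ¬ (f v ≈ b) → (∃ λ w → f w ≈ b) → ∃ λ w → updateAt f v (const y) w ≈ b
      keep fv≉b (w , fw≈b) =
        w , ≈.trans (≈.reflexive (updateAt-minimal w v f λ { refl → fv≉b fw≈b })) fw≈b

    precoloured : ∀ {v} → v ∈ Vc → f v ≈ 0# ⊎ f v ≈ 1#
    precoloured {v} v∈ with g (v , v∈) | compatible v∈
    ... | zero     | fv≈0 = inj₁ fv≈0
    ... | suc zero | fv≈1 = inj₂ fv≈1

    -- Changing the value at `v` affects only the edges at `v`. All of these start at or above the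
    -- contrast of `v` and `u` and would end above it, and the edge from `v` to `u` starts exactly
    -- there.
    not-movable : ∀ {v u y} → ¬ (f v ≈ 0#) → ¬ (f v ≈ 1#) → 0# ≤ y → y ≤ 1# → v ~ u →
                  (∀ {w} → v ~ w → dist (f v) (f u) ≤ dist (f v) (f w)) →
                  ¬ (∀ {w} → v ~ w → dist (f v) (f u) < dist y (f w))
    not-movable {v} {u} {y} fv≉0 fv≉1 0≤y y≤1 v~u nearest farther =
      not-improvable (greyscaleMove fv≉0 fv≉1 0≤y y≤1) comp kept v~u ≤-refl
        (<-respʳ-≈ (≈.sym (moved v~u)) (farther v~u))
      where
      h = updateAt f v (const y)
      moved : ∀ {w} → v ~ w → dist (h v) (h w) ≈ dist y (f w)
      moved {w} v~w = dist-cong (≈.reflexive (updateAt-updates v f))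
        (≈.reflexive (updateAt-minimal w v f λ { refl → ~-irrefl refl v~w }))
      -- The vertex `v` is not in `Vc`, since its value is neither 0 nor 1.
      comp : Compatible Vc g h
      comp {w} w∈ = ≈.trans (≈.reflexive (updateAt-minimal w v f
        λ { refl → [ fv≉0 , fv≉1 ]′ (precoloured w∈) })) (compatible w∈)
      kept : ∀ {w z} → w ~ z → KeptOrRaised (contrast f) (contrast h) (dist (f v) (f u)) (w , z)
      kept {w} {z} w~z with w ≟ᶠ v | z ≟ᶠ v
      ... | yes refl | _        = inj₂ (nearest w~z , <-respʳ-≈ (≈.sym (moved w~z)) (farther w~z))
      ... | no _     | yes refl = inj₂
        ( ≤-respʳ-≈ (dist-sym _ _) (nearest (~-sym w~z))
        , <-respʳ-≈ (≈.trans (≈.sym (moved (~-sym w~z))) (dist-sym (h z) (h w)))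
                    (farther (~-sym w~z)))
      ... | no w≢v   | no z≢v   = inj₁ (≈.sym (dist-cong
        (≈.reflexive (updateAt-minimal w v f w≢v)) (≈.reflexive (updateAt-minimal z v f z≢v))))

    -- Let `a` be the least contrast at `v`. A side without a neighbour at distance exactly `a`
    -- would let `moveUp` or `moveDown` shift `v` towards it, against `not-movable`.
    balanced : ∀ {v w₀} → ¬ (f v ≈ 0#) → ¬ (f v ≈ 1#) → v ~ w₀ →
               ∃ λ u → v ~ u × (∃ λ w → v ~ w × f w + dist (f v) (f u) ≈ f v)
                             × (∃ λ w → v ~ w × f v + dist (f v) (f u) ≈ f w)
    balanced {v} {w₀} fv≉0 fv≉1 v~w₀ = u , v~u , below , above
      where
      open IsGreyscale isGreyscale
      neighbours = filter (v ~?_) (allFin n)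
      distance : Fin n → Carrier
      distance w = dist (f v) (f w)
      -- The default `w₀` is itself a neighbour, so the minimiser is one too.
      u = argmin distance w₀ neighbours
      a = distance u
      v~u : v ~ u
      v~u = argmin-all distance v~w₀ (all-filter (v ~?_) (allFin n))
      nearest : ∀ {w} → v ~ w → a ≤ dist (f v) (f w)
      nearest {w} v~w = All.lookup (f[argmin]≤f[xs] {f = distance} w₀ neighbours)
        (∈-filter⁺ (v ~?_) (∈-allFin w) v~w)
      above : ∃ λ w → v ~ w × f v + a ≈ f w
      -- The search over finitely many vertices is decidable, so it suffices to refute that it
      -- fails.
      above = decidable-stable (any? λ w → (v ~? w) ×-dec (f v + a ≟ f w)) λ none →
        let y , v≤y , y≤1 , farther = moveUp (v ~_) f (≤∧≉⇒< (≤one v) fv≉1) nearest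
                                        (λ v~w eq → none (_ , v~w , eq))
        in not-movable fv≉0 fv≉1 (≤-trans (nonNeg v) v≤y) y≤1 v~u nearest farther
      below : ∃ λ w → v ~ w × f w + a ≈ f v
      below = decidable-stable (any? λ w → (v ~? w) ×-dec (f w + a ≟ f v)) λ none →
        let y , y≤v , 0≤y , farther = moveDown (v ~_) f (≤∧≉⇒< (nonNeg v) (fv≉0 ∘ ≈.sym)) nearest
                                        (λ v~w eq → none (_ , v~w , eq))
        in not-movable fv≉0 fv≉1 0≤y (≤-trans y≤v (≤one v)) v~u nearest farther

    -- A compatible greyscale with all contrasts at least ⅓.

    module _ (properOn : ProperOn G Vc g) (c : Fin n → Fin 2)
             (proper : ∀ {u v} → u ~ v → c u ≢ c v) {r : Fin n} (r∉ : r ∉ Vc) where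
      open IsGreyscale isGreyscale

      -- The classes are named relative to the free vertex `r`, so that `α` is certainly attained.
      -- This supplies the value 0 or 1 when it does not occur on `Vc`.
      fill : Carrier → Carrier → Fin n → Carrier
      fill α β v = if does (v ∈? Vc) then f v else (if does (c v ≟ᶠ c r) then α else β)

      -- Indexing by the value lets a match on the view replace `fill α β v` in the goal.
      data FillView (α β : Carrier) (v : Fin n) : Carrier → Set where
        fixed : v ∈ Vc → FillView α β v (f v)
        same  : v ∉ Vc → c v ≡ c r → FillView α β v α
        other : v ∉ Vc → c v ≢ c r → FillView α β v β

      fillView : ∀ α β v → FillView α β v (fill α β v)
      fillView α β v with v ∈? Vc | c v ≟ᶠ c r
      ... | yes v∈ | _     = fixed v∈
      ... | no  v∉ | yes e = same v∉ e
      ... | no  v∉ | no ¬e = other v∉ ¬e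

      fill-fixed : ∀ α β {v} → v ∈ Vc → fill α β v ≡ f v
      fill-fixed α β {v} v∈ with fill α β v | fillView α β v
      ... | _ | fixed _    = refl
      ... | _ | same v∉ _  = contradiction v∈ v∉
      ... | _ | other v∉ _ = contradiction v∈ v∉

      fill-root : ∀ α β → fill α β r ≡ α
      fill-root α β with fill α β r | fillView α β r
      ... | _ | fixed r∈   = contradiction r∈ r∉
      ... | _ | same _ _   = refl
      ... | _ | other _ ¬e = contradiction refl ¬e

      -- By `contrast-bound` it suffices to treat the filled greyscale. An edge inside `Vc` joins 0
      -- and 1 because `g` is proper, an edge leaving `Vc` is covered by assumption, and an edge
      -- between free vertices joins the two classes, hence `α` and `β`.
      fill-bound : ∀ {α β} →
        0# ≤ α → α ≤ 1# → 0# ≤ β → β ≤ 1# → Apart α β →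
        (∀ {v} → v ∈ Vc → Apart (f v) α × Apart (f v) β) →
        (∃ λ v → fill α β v ≈ 0#) → (∃ λ v → fill α β v ≈ 1#) →
        ∀ {u v} → u ~ v → Apart (f u) (f v)
      fill-bound {α} {β} 0≤α α≤1 0≤β β≤1 α#β Vc#αβ has0 has1 =
        contrast-bound grey comp apart
        where
        everywhere : ∀ (P : Carrier → Set) → (∀ v → P (f v)) → P α → P β → ∀ v → P (fill α β v)
        everywhere P Pf Pα Pβ v with fill α β v | fillView α β v
        ... | _ | fixed _   = Pf v
        ... | _ | same _ _  = Pα
        ... | _ | other _ _ = Pβ
        grey : IsGreyscale (fill α β)
        grey = record
          { nonNeg = everywhere (0# ≤_) nonNeg 0≤α 0≤β
          ; ≤one   = everywhere (_≤ 1#) ≤one α≤1 β≤1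
          ; 0∈Im   = has0
          ; 1∈Im   = has1
          }
        comp : Compatible Vc g (fill α β)
        comp u∈ = ≈.trans (≈.reflexive (fill-fixed α β u∈)) (compatible u∈)
        -- With two colours only, free vertices outside the class of `r` share a colour and so are
        -- not adjacent.
        both-differ⇒≡ : ∀ {i j k : Fin 2} → i ≢ k → j ≢ k → i ≡ j
        both-differ⇒≡ {zero}     {zero}     _ _ = refl
        both-differ⇒≡ {suc zero} {suc zero} _ _ = refl
        both-differ⇒≡ {zero} {suc zero} {zero}     i≢k _ = contradiction refl i≢k
        both-differ⇒≡ {zero} {suc zero} {suc zero} _ j≢k = contradiction refl j≢k
        both-differ⇒≡ {suc zero} {zero} {zero}     _ j≢k = contradiction refl j≢k
        both-differ⇒≡ {suc zero} {zero} {suc zero} i≢k _ = contradiction refl i≢k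
        apart : ∀ {u v} → u ~ v → Apart (fill α β u) (fill α β v)
        apart {u} {v} u~v with fill α β u | fillView α β u | fill α β v | fillView α β v
        ... | _ | fixed u∈   | _ | fixed v∈   =
          apart-resp (compatible u∈) (compatible v∈) (apart-⟦⟧ (properOn u∈ v∈ u~v))
        ... | _ | fixed u∈   | _ | same _ _   = proj₁ (Vc#αβ u∈)
        ... | _ | fixed u∈   | _ | other _ _  = proj₂ (Vc#αβ u∈)
        ... | _ | same _ _   | _ | fixed v∈   = apart-sym (proj₁ (Vc#αβ v∈))
        ... | _ | same _ e   | _ | same _ e′  = contradiction (≡.trans e (≡.sym e′)) (proper u~v)
        ... | _ | same _ _   | _ | other _ _  = α#β
        ... | _ | other _ _  | _ | fixed v∈   = apart-sym (proj₂ (Vc#αβ v∈))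
        ... | _ | other _ _  | _ | same _ _   = apart-sym α#β
        ... | _ | other _ ¬e | _ | other _ ¬e′ = contradiction (both-differ⇒≡ ¬e ¬e′) (proper u~v)

      edges-apart : Nonempty Vc → ∀ {u v} → u ~ v → Apart (f u) (f v)
      edges-apart (s , s∈) with any? (λ v → (v ∈? Vc) ×-dec (f v ≟ 0#))
                              | any? (λ v → (v ∈? Vc) ×-dec (f v ≟ 1#))
      ... | yes (v₀ , v₀∈ , fv₀≈0) | yes (v₁ , v₁∈ , fv₁≈1) =
        fill-bound {⅓} {⅔} 0≤⅓ ⅓≤1 0≤⅔ ⅔≤1 (≤-dist⁺ʳ ⅓+⅓≤⅔)
          (λ v∈ → [ (λ e → apart-respˡ e (≤-dist⁺ʳ 0+⅓≤⅓) , apart-respˡ e (≤-dist⁺ʳ 0+⅓≤⅔))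
                  , (λ e → apart-respˡ e (≤-dist⁺ ⅓+⅓≤1) , apart-respˡ e (≤-dist⁺ ⅔+⅓≤1))
                  ]′ (precoloured v∈))
          (v₀ , ≈.trans (≈.reflexive (fill-fixed _ _ v₀∈)) fv₀≈0)
          (v₁ , ≈.trans (≈.reflexive (fill-fixed _ _ v₁∈)) fv₁≈1)
      -- Here `Vc` has only the value 0, so 1 must come from a free vertex, namely `r`; the other
      -- class takes ⅓, which is far enough from both.
      ... | _ | no none =
        fill-bound {1#} {⅓} 0≤1 ≤-refl 0≤⅓ ⅓≤1 (≤-dist⁺ ⅓+⅓≤1)
          (λ v∈ → apart-respˡ (all0 v∈) (≤-dist⁺ʳ 0+⅓≤1) , apart-respˡ (all0 v∈) (≤-dist⁺ʳ 0+⅓≤⅓))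
          (s , ≈.trans (≈.reflexive (fill-fixed _ _ s∈)) (all0 s∈))
          (r , ≈.reflexive (fill-root _ _))
        where
        all0 : ∀ {v} → v ∈ Vc → f v ≈ 0#
        all0 v∈ = [ id , (λ e → contradiction (_ , v∈ , e) none) ]′ (precoloured v∈)
      -- The mirror case: `Vc` has only the value 1, and `r` provides 0.
      ... | no none | yes _ =
        fill-bound {0#} {⅔} ≤-refl 0≤1 0≤⅔ ⅔≤1 (≤-dist⁺ʳ 0+⅓≤⅔)
          (λ v∈ → apart-respˡ (all1 v∈) (≤-dist⁺ 0+⅓≤1) , apart-respˡ (all1 v∈) (≤-dist⁺ ⅔+⅓≤1))
          (r , ≈.reflexive (fill-root _ _))
          (s , ≈.trans (≈.reflexive (fill-fixed _ _ s∈)) (all1 s∈))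
        where
        all1 : ∀ {v} → v ∈ Vc → f v ≈ 1#
        all1 v∈ = [ (λ e → contradiction (_ , v∈ , e) none) , id ]′ (precoloured v∈)

    -- The possible values strictly between 0 and 1.

    module _ (connected : Connected G) (apart : ∀ {u v} → u ~ v → Apart (f u) (f v)) where
      open IsGreyscale isGreyscale

      -- A path from `v` to a vertex of value 0 cannot be empty, so it begins with an edge at `v`.
      has-neighbour : ∀ {v} → ¬ (f v ≈ 0#) → ∃ λ w → v ~ w
      has-neighbour {v} fv≉0 with v₀ , fv₀≈0 ← 0∈Im with connected v v₀
      ... | ε       = contradiction fv₀≈0 fv≉0
      ... | v~w ◅ _ = _ , v~w

      interior-step : ∀ {v} → ¬ (f v ≈ 0#) → ¬ (f v ≈ 1#) →
                      ∃ λ a → ⅓ ≤ a × (∃ λ x → f x + a ≈ f v) × (∃ λ y → f v + a ≈ f y)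
      interior-step fv≉0 fv≉1 =
        let u , v~u , (x , _ , below) , (y , _ , above) =
              balanced fv≉0 fv≉1 (proj₂ (has-neighbour fv≉0))
        in _ , apart v~u , (x , below) , (y , above)

      -- Some vertex has a value lower by `a ≥ ⅓`, and that value is still nonnegative.
      ⅓≤interior : ∀ {v} → ¬ (f v ≈ 0#) → ¬ (f v ≈ 1#) → ⅓ ≤ f v
      ⅓≤interior fv≉0 fv≉1 =
        let a , ⅓≤a , (x , below) , _ = interior-step fv≉0 fv≉1
        in ≤-respʳ-≈ below (≤-respˡ-≈ (+-identityˡ ⅓) (+-mono-≤ (nonNeg x) ⅓≤a))

      interior+⅓≤1 : ∀ {v} → ¬ (f v ≈ 0#) → ¬ (f v ≈ 1#) → f v + ⅓ ≤ 1#
      interior+⅓≤1 {v} fv≉0 fv≉1 =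
        let a , ⅓≤a , _ , (y , above) = interior-step fv≉0 fv≉1
        in ≤-trans (+-monoʳ-≤ (f v) ⅓≤a) (≤-respˡ-≈ (≈.sym above) (≤one y))

      -- If `f x` is not 0, it is interior as well, being less than `f v`. Then `f x ≥ ⅓` forces
      -- `f v ≥ ⅔`, which is also the upper bound for interior values.
      below-interior : ∀ {v x} → ¬ (f v ≈ 0#) → ¬ (f v ≈ 1#) →
                       f x + ⅓ ≤ f v → f x ≈ 0# ⊎ f v ≈ ⅔
      below-interior {v} {x} fv≉0 fv≉1 fx+⅓≤fv with f x ≟ 0#
      ... | yes fx≈0 = inj₁ fx≈0
      ... | no  fx≉0 = inj₂ (antisym
        (+-cancelʳ-≤ ⅓ (≤-respʳ-≈ (≈.sym ⅔+⅓≈1) (interior+⅓≤1 fv≉0 fv≉1)))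
        (begin
          ⅔         ≈⟨ ⅔≈⅓+⅓ ⟩
          ⅓ + ⅓     ≤⟨ +-monoˡ-≤ ⅓ (⅓≤interior fx≉0 fx≉1) ⟩
          f x + ⅓   ≤⟨ fx+⅓≤fv ⟩
          f v       ∎))
        where
        open ≤-Reasoning
        fx≉1 : ¬ (f x ≈ 1#)
        fx≉1 fx≈1 = fv≉1 (antisym (≤one v) (begin
          1#       ≈⟨ fx≈1 ⟨
          f x      ≤⟨ ≤+⅓ (f x) ⟩
          f x + ⅓  ≤⟨ fx+⅓≤fv ⟩
          f v      ∎))

      -- The mirror argument: an interior `f y` is at most ⅔, which pushes `f v` down to its lower
      -- bound ⅓.
      above-interior : ∀ {v y} → ¬ (f v ≈ 0#) → ¬ (f v ≈ 1#) →
                       f v + ⅓ ≤ f y → f y ≈ 1# ⊎ f v ≈ ⅓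
      above-interior {v} {y} fv≉0 fv≉1 fv+⅓≤fy with f y ≟ 1#
      ... | yes fy≈1 = inj₁ fy≈1
      ... | no  fy≉1 = inj₂ (antisym
        (+-cancelʳ-≤ ⅓ (+-cancelʳ-≤ ⅓ (begin
          f v + ⅓ + ⅓ ≤⟨ +-monoˡ-≤ ⅓ fv+⅓≤fy ⟩
          f y + ⅓     ≤⟨ interior+⅓≤1 fy≉0 fy≉1 ⟩
          1#          ≈⟨ ⅔+⅓≈1 ⟨
          ⅔ + ⅓       ≈⟨ +-congʳ ⅔≈⅓+⅓ ⟩
          ⅓ + ⅓ + ⅓   ∎)))
        (⅓≤interior fv≉0 fv≉1))
        where
        open ≤-Reasoning
        fy≉0 : ¬ (f y ≈ 0#)
        fy≉0 fy≈0 = fv≉0 (antisym (begin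
          f v      ≤⟨ ≤+⅓ (f v) ⟩
          f v + ⅓  ≤⟨ fv+⅓≤fy ⟩
          f y      ≈⟨ fy≈0 ⟩
          0#       ∎) (nonNeg v))

      interior-values : ∀ {v} → ¬ (f v ≈ 0#) → ¬ (f v ≈ 1#) → f v ≈ ⅓ ⊎ f v ≈ ½ ⊎ f v ≈ ⅔
      interior-values {v} fv≉0 fv≉1 =
        let a , ⅓≤a , (x , below) , (y , above) = interior-step fv≉0 fv≉1
        in combine below above
             (below-interior fv≉0 fv≉1 (≤-respʳ-≈ below (+-monoʳ-≤ (f x) ⅓≤a)))
             (above-interior fv≉0 fv≉1 (≤-respʳ-≈ above (+-monoʳ-≤ (f v) ⅓≤a)))
        where
        open ≤-Reasoning
        combine : ∀ {a x y} → x + a ≈ f v → f v + a ≈ y →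
                  x ≈ 0# ⊎ f v ≈ ⅔ → y ≈ 1# ⊎ f v ≈ ⅓ → f v ≈ ⅓ ⊎ f v ≈ ½ ⊎ f v ≈ ⅔
        combine _ _ _            (inj₂ fv≈⅓) = inj₁ fv≈⅓
        combine _ _ (inj₂ fv≈⅔)  _           = inj₂ (inj₂ fv≈⅔)
        -- The step `a` leads from 0 to `f v` and from `f v` to 1, so `f v` is the midpoint.
        combine {a} {x} {y} below above (inj₁ x≈0) (inj₁ y≈1) =
          inj₂ (inj₁ (x+x≈1⇒x≈½ (begin-equality
            f v + f v       ≈⟨ +-congˡ below ⟨
            f v + (x + a)   ≈⟨ +-congˡ (+-congʳ x≈0) ⟩
            f v + (0# + a)  ≈⟨ +-congˡ (+-identityˡ a) ⟩
            f v + a         ≈⟨ above ⟩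
            y               ≈⟨ y≈1 ⟩
            1#              ∎)))

theorem5p3 : (ℝ : Reals) → let open Reals ℝ in let open Contrast ℝ in
    ∀ {n : ℕ} (G : Graph n) → Connected G → HasChromaticNumber G 2 →
    (Vc : Subset n) → Nonempty Vc → Vc ⊂ ⊤ →
    (g : InitialColouring Vc) → ProperOn G Vc g →
    (f : Fin n → Carrier) → IsMaximumContrast G Vc g f →
    Im f ⊆ (0# ∷ ⅓ ∷ ½ ∷ ⅔ ∷ 1# ∷ [])
theorem5p3 ℝ G connected ((c , proper) , _) Vc nonempty (_ , r , _ , r∉) g properOn f max v =
  value (f v ≟ 0#) (f v ≟ 1#)
  where
  open Reals ℝ using (0#; 1#; _≈_; ⅓; ½; ⅔; setoid)
  open RealProperties ℝ using (_≟_)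
  open ContrastImprovement ℝ
  open SetoidMembership setoid using () renaming (_∈_ to _∈ₗ_)
  value : Dec (f v ≈ 0#) → Dec (f v ≈ 1#) → f v ∈ₗ (0# ∷ ⅓ ∷ ½ ∷ ⅔ ∷ 1# ∷ [])
  value (yes fv≈0) _          = here fv≈0
  value (no _)     (yes fv≈1) = there (there (there (there (here fv≈1))))
  value (no fv≉0)  (no fv≉1)  =
    [ there ∘ here , [ there ∘ there ∘ here , there ∘ there ∘ there ∘ here ]′ ]′
      (interior-values max connected (edges-apart max properOn c proper r∉ nonempty) fv≉0 fv≉1)
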